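{- Let $\pi$ and $\pi'$ be two different non-increasing degree sequences of trees on the same number $n$ of vertices, with $\pi\lhd\pi'$. Let $T^*$ be a last tree in the $S$-order among $\mathscr{T}_\pi$ and $(T')^*$ a last tree in the $S$-order among $\mathscr{T}_{\pi'}$. Then $T^*\prec_s (T')^*$.
   Context: For a tree degree sequence $\pi$, $\mathscr{T}_\pi$ is the set of all trees with degree sequence $\pi$. For a graph $G$ on $n$ vertices with adjacency eigenvalues $\lambda_1,\dots,\lambda_n$, $S_k(G)=\sum_{i=1}^n\lambda_i^k$. For $n$-vertex graphs $G_1,G_2$, $G_1\prec_s G_2$ means that for some $k\in\{1,\dots,n-1\}$, $S_i(G_1)=S_i(G_2)$ for $i=0,\dots,k-1$ and $S_k(G_1)<S_k(G_2)$; $G_1=_sG_2$ means $S_i(G_1)=S_i(G_2)$ for all $i$; $G_1\preceq_sG_2$ means $G_1\prec_sG_2$ or $G_1=_sG_2$. A last tree among a set $\mathscr{T}$ is $T_0\in\mathscr{T}$ with $T\preceq_s T_0$ for all $T\in\mathscr{T}$. For non-increasing sequences $\pi=(d_0,\dots,d_{n-1})$, $\pi'=(d_0',\dots,d_{n-1}')$, $\pi\lhd\pi'$ means $\sum_{i=0}^k d_i\le\sum_{i=0}^k d_i'$ for all $k$ and $\sum_{i=0}^{n-1}d_i=\sum_{i=0}^{n-1}d_i'$.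
   Formalization: The case n = 4 is excluded: there the only pair is (2,2,1,1), (3,1,1,1), whose trees P₄ and K₁,₃ agree in S₀,…,S₃ and differ first in S₄ (14 < 18), while the S-order only allows k ≤ n−1 = 3, so the claim fails. -}

module Defs where

open import Level as Level using (Level; _⊔_)
open import Algebra.Apartness.Bundles using (HeytingField)
open import Algebra.Bundles using (CommutativeRing)
open import Algebra.Properties.CommutativeMonoid.Sum using (sum)
import Algebra.Properties.Semiring.Exp as Exp
open import Data.Bool.Base using (Bool; false; T; if_then_else_)
open import Data.Fin.Base as Fin using (Fin; zero; suc; toℕ; inject₁; inject≤; fromℕ)
open import Data.Fin.Properties using (toℕ<n)
open import Data.Fin.Subset using (Subset; ∣_∣)
open import Data.Nat.Base as ℕ using (ℕ; _∸_)
open import Data.Nat.Properties using (+-0-commutativeMonoid)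
open import Data.Product.Base using (∃; ∃-syntax; _×_)
open import Data.Sum.Base using (_⊎_)
import Data.Vec.Base as Vec
open import Data.Vec.Functional using (Vector)
open import Data.Vec.Functional.Relation.Binary.Permutation using (_↭_)
open import Function.Bundles using (_⇔_)
open import Function.Definitions using (Injective)
open import Relation.Binary.Construct.Closure.ReflexiveTransitive using (Star)
open import Relation.Binary.Core using (Rel; _Preserves_⟶_)
open import Relation.Binary.PropositionalEquality.Core using (_≡_)
open import Relation.Binary.Structures using (IsStrictPartialOrder)
open import Relation.Nullary.Negation.Core using (¬_)
open import Relation.Unary using (Pred; _∈_)

record Graph (n : ℕ) : Set where
  field
    adj    : Fin n → Fin n → Bool
    sym    : ∀ u v → adj u v ≡ adj v u
    irrefl : ∀ v → adj v v ≡ false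

  Adj : Rel (Fin n) _
  Adj u v = T (adj u v)

  neighbours : Fin n → Subset n
  neighbours v = Vec.tabulate (adj v)

  degree : Vector ℕ n
  degree v = ∣ neighbours v ∣

  Connected : Set
  Connected = ∀ u v → Star Adj u v

  -- A cycle of length k + 3: distinct vertices c₀, …, cₖ₊₂ with cᵢ ~ cᵢ₊₁
  -- and cₖ₊₂ ~ c₀.
  record Cycle : Set where
    field
      k         : ℕ
      vertex    : Fin (3 ℕ.+ k) → Fin n
      injective : Injective _≡_ _≡_ vertex
      step      : ∀ i → Adj (vertex (inject₁ i)) (vertex (suc i))
      close     : Adj (vertex (fromℕ (2 ℕ.+ k))) (vertex zero)

  IsTree : Set
  IsTree = Connected × ¬ Cycle

open Graph public using (IsTree; degree)

NonIncreasing : ∀ {n} → Pred (Vector ℕ n) _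
NonIncreasing π = π Preserves Fin._≤_ ⟶ ℕ._≥_

-- The trees with degree sequence π; a tree determines its degree sequence
-- only up to the order in which its vertices are listed.
𝒯 : ∀ {n} → Vector ℕ n → Pred (Graph n) _
𝒯 π G = IsTree G × degree G ↭ π

IsTreeDegreeSequence : ∀ {n} → Pred (Vector ℕ n) _
IsTreeDegreeSequence π = ∃[ G ] G ∈ 𝒯 π

-- d₀ + ⋯ + dₖ
partialSum : ∀ {n} → Vector ℕ n → Fin n → ℕ
partialSum π k =
  sum +-0-commutativeMonoid {ℕ.suc (toℕ k)} (λ i → π (inject≤ i (toℕ<n k)))

infix 4 _⊲_

_⊲_ : ∀ {n} → Rel (Vector ℕ n) _
π ⊲ π′ = (∀ k → partialSum π k ℕ.≤ partialSum π′ k)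
       × sum +-0-commutativeMonoid π ≡ sum +-0-commutativeMonoid π′

-- The library has no real numbers. Ordered fields are axiomatised here in the
-- constructive style, without deciding x < y, so that both the real numbers of
-- constructive analysis and the classical ones qualify.
record OrderedField (c ℓ₁ ℓ₂ ℓ₃ : Level) : Set (Level.suc (c ⊔ ℓ₁ ⊔ ℓ₂ ⊔ ℓ₃)) where
  infix 4 _<_
  field
    heytingField : HeytingField c ℓ₁ ℓ₂

  open HeytingField heytingField public

  field
    _<_                  : Rel Carrier ℓ₃
    isStrictPartialOrder : IsStrictPartialOrder _≈_ _<_
    #⇔<⊎>                : ∀ {x y} → (x # y) ⇔ (x < y ⊎ y < x)
    +-monoˡ-<            : ∀ {x y} z → x < y → x + z < y + z
    *-pos                : ∀ {x y} → 0# < x → 0# < y → 0# < x * y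

  commutativeRing : CommutativeRing c ℓ₁
  commutativeRing = record { isCommutativeRing = isCommutativeRing }

  open CommutativeRing commutativeRing public
    using (semiring; +-commutativeMonoid)

  Σ[_] : ∀ {n} → Vector Carrier n → Carrier
  Σ[_] = sum +-commutativeMonoid

module _ {c ℓ₁ ℓ₂ ℓ₃ : Level} (K : OrderedField c ℓ₁ ℓ₂ ℓ₃) where
  open OrderedField K
  open Exp semiring using (_^_)

  adjacencyMatrix : ∀ {n} → Graph n → Fin n → Fin n → Carrier
  adjacencyMatrix G u v = if Graph.adj G u v then 1# else 0#

  -- The n eigenvalues of the symmetric matrix A(G), each repeated according to
  -- the dimension of its eigenspace: λⱼ belongs to the j-th vector of a basis
  -- of Kⁿ consisting of eigenvectors.
  record Spectrum {n : ℕ} (G : Graph n) : Set (c ⊔ ℓ₁) where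
    field
      eigenvalue  : Vector Carrier n
      eigenvector : Fin n → Vector Carrier n
      eigen       : ∀ j u →
        Σ[ (λ v → adjacencyMatrix G u v * eigenvector j v) ]
          ≈ eigenvalue j * eigenvector j u
      independent : ∀ (a : Vector Carrier n) →
        (∀ u → Σ[ (λ j → a j * eigenvector j u) ] ≈ 0#) → ∀ j → a j ≈ 0#
      spanning    : ∀ (x : Vector Carrier n) →
        ∃ λ (a : Vector Carrier n) →
          ∀ u → Σ[ (λ j → a j * eigenvector j u) ] ≈ x u

  module SOrder {n : ℕ} (spectrum : (G : Graph n) → Spectrum G) where

    S : ℕ → Graph n → Carrier
    S k G = Σ[ (λ i → Spectrum.eigenvalue (spectrum G) i ^ k) ]

    -- The bound k ≤ n − 1 matters for n = 4: the path P₄ and the star K₁,₃ agree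
    -- in S₀, …, S₃ and first differ in S₄, so neither ≺ₛ nor =ₛ relates them.
    infix 4 _≺ₛ_ _=ₛ_ _≼ₛ_

    _≺ₛ_ : Rel (Graph n) (ℓ₁ ⊔ ℓ₃)
    G₁ ≺ₛ G₂ = ∃[ k ] (1 ℕ.≤ k × k ℕ.≤ n ∸ 1
                      × (∀ i → i ℕ.< k → S i G₁ ≈ S i G₂)
                      × S k G₁ < S k G₂)

    _=ₛ_ : Rel (Graph n) ℓ₁
    G₁ =ₛ G₂ = ∀ i → S i G₁ ≈ S i G₂

    _≼ₛ_ : Rel (Graph n) (ℓ₁ ⊔ ℓ₃)
    G₁ ≼ₛ G₂ = G₁ ≺ₛ G₂ ⊎ G₁ =ₛ G₂

    IsLastIn : ∀ {ℓ} → Pred (Graph n) ℓ → Pred (Graph n) (ℓ ⊔ ℓ₁ ⊔ ℓ₃)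
    IsLastIn 𝒮 T₀ = T₀ ∈ 𝒮 × (∀ T → T ∈ 𝒮 → T ≼ₛ T₀)

{-# OPTIONS --safe #-}

-- The number of closed walks of length k is the trace of the k-th power of the
-- adjacency matrix A, hence equals Sₖ. In a tree S₁ = S₃ = 0, S₂ = Σ dᵢ, and,
-- since two distinct vertices have at most one common neighbour,
-- S₄ + Σ dᵢ = 2 Σ dᵢ². Thus S₀, …, S₃ agree on 𝒯 π and 𝒯 π′, whereas S₄ is
-- strictly larger on 𝒯 π′: if π ⊲ π′ and π ≠ π′, then Abel summation gives
-- Σ dᵢ² ≤ Σ dᵢ dᵢ′, so that 2 Σ dᵢ² ≤ 2 Σ dᵢ dᵢ′ < Σ dᵢ² + Σ dᵢ′².
-- For n ≤ 3 all trees have the same Σ dᵢ², so this inequality and n ≠ 4 force n ≥ 5,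
-- which makes 4 an admissible index.
module Submission where

open import Defs
open import Algebra.Bundles using (CommutativeRing)
import Algebra.Properties.CommutativeSemigroup as CommutativeSemigroupProperties
import Algebra.Properties.Group as GroupProperties
import Algebra.Properties.Ring as RingProperties
import Algebra.Properties.Semiring.Exp as Exp
import Algebra.Properties.Semiring.Mult as Mult
import Algebra.Properties.Semiring.Sum as SemiringSum
open import Data.Bool.Base using (Bool; true; false; T; if_then_else_)
open import Data.Bool.Properties using (T-≡)
open import Data.Empty using (⊥; ⊥-elim)
open import Data.Fin.Base using (Fin; zero; suc)
open import Data.Fin.Patterns using (0F; 1F; 2F)
open import Data.Fin.Properties using (punchInᵢ≢i; suc-injective; ¬∀⟶∃¬)
open import Data.Fin.Subset using (∣_∣)
open import Data.Nat.Base as ℕ using (ℕ; zero; suc; z≤n; s≤s; _∸_)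
import Data.Nat.Properties as ℕ
open import Data.Nat.Solver using (module +-*-Solver)
open import Data.Product.Base using (_,_; proj₁; proj₂)
open import Data.Sum.Base using (inj₁; inj₂)
open import Data.Unit.Base using (tt)
import Data.Vec.Base as Vec
open import Data.Vec.Base using ([]; _∷_)
open import Data.Vec.Functional using (Vector; tail; removeAt)
open import Data.Vec.Functional.Relation.Binary.Permutation using (_↭_)
open import Data.Vec.Relation.Unary.All using ([]; _∷_)
open import Data.Vec.Relation.Unary.AllPairs using ([]; _∷_)
open import Data.Vec.Relation.Unary.Unique.Propositional.Properties using (lookup-injective)
open import Function.Base using (id; _∘_)
open import Function.Bundles using (Equivalence)
open import Level using (_⊔_)
open import Relation.Binary.Construct.Closure.ReflexiveTransitive using (ε; _◅_)
open import Relation.Binary.PropositionalEquality as ≡ using (_≡_; _≢_; _≗_)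
import Relation.Binary.Reasoning.Setoid as SetoidReasoning
open import Relation.Binary.Definitions using (tri<; tri≈; tri>)
open import Relation.Binary.Structures using (IsStrictPartialOrder)
open import Relation.Nullary.Decidable using (yes; no)
open import Relation.Nullary.Negation using (¬_; contradiction)

open SemiringSum ℕ.+-*-semiring
  using (sum; sum-cong-≗; sum-remove; sum-permute; ∑-distrib-+; ∑-comm; sum-replicate-zero;
         *-distribˡ-sum; *-distribʳ-sum)

-- Matrices of natural numbers and their traces

Matrix : ℕ → Set
Matrix n = Fin n → Fin n → ℕ

infixr 7 _⊗_

_⊗_ : ∀ {n} → Matrix n → Matrix n → Matrix n
(M ⊗ N) u w = sum (λ v → M u v ℕ.* N v w)

trace : ∀ {n} → Matrix n → ℕ
trace M = sum (λ u → M u u)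

entry : Bool → ℕ
entry b = if b then 1 else 0

adjacency : ∀ {n} → Graph n → Matrix n
adjacency G u v = entry (Graph.adj G u v)

-- Power sums of eigenvalues as traces

module Spectral {c ℓ₁ ℓ₂ ℓ₃} (K : OrderedField c ℓ₁ ℓ₂ ℓ₃) where
  open OrderedField K using (commutativeRing; Σ[_]; _<_; _#_; isStrictPartialOrder;
    #⇔<⊎>; +-monoˡ-<; *-pos; invertible⇒#)
  open CommutativeRing commutativeRing hiding (zero)
  open Exp semiring using (_^_; ^-homo-*)
  open Mult semiring using (×-homo-+; ×1-homo-*) renaming (_×_ to _×ₖ_)
  open CommutativeSemigroupProperties *-commutativeSemigroup using (x∙yz≈y∙xz)
  open SetoidReasoning setoid
  module KΣ = SemiringSum semiring
  module < = IsStrictPartialOrder isStrictPartialOrder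

  ι : ℕ → Carrier
  ι m = m ×ₖ 1#

  1#0 : 1# # 0#
  1#0 = invertible⇒# (1# , trans (*-identityˡ _) 1-0≈1 , trans (*-identityʳ _) 1-0≈1)
    where
    1-0≈1 : 1# - 0# ≈ 1#
    1-0≈1 = trans (+-congˡ (RingProperties.-0#≈0# ring)) (+-identityʳ 1#)

  -- Apartness of 1 and 0 leaves only the case 1 < 0; there -1 is positive, hence so is its square,
  -- which is 1.
  0<1 : 0# < 1#
  0<1 with Equivalence.to #⇔<⊎> 1#0
  ... | inj₂ 0<1 = 0<1
  ... | inj₁ 1<0 = <.<-respʳ-≈ -1*-1≈1 (*-pos 0<-1 0<-1)
    where
    0<-1 : 0# < - 1#
    0<-1 = <.<-respˡ-≈ (-‿inverseʳ 1#) (<.<-respʳ-≈ (+-identityˡ _) (+-monoˡ-< (- 1#) 1<0))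
    -1*-1≈1 : - 1# * - 1# ≈ 1#
    -1*-1≈1 = trans (RingProperties.-1*x≈-x ring (- 1#)) (RingProperties.-‿involutive ring 1#)

  ι-mono-< : ∀ {m n} → m ℕ.< n → ι m < ι n
  ι-mono-< = go ∘ ℕ.≤⇒≤′
    where
    ι-< : ∀ m → ι m < ι (suc m)
    ι-< m = <.<-respˡ-≈ (+-identityˡ _) (+-monoˡ-< (ι m) 0<1)
    go : ∀ {m n} → m ℕ.<′ n → ι m < ι n
    go {m} (ℕ.≤′-reflexive ≡.refl)  = ι-< m
    go {n = suc n} (ℕ.≤′-step m<n) = <.trans (go m<n) (ι-< n)

  ι-sum : ∀ {n} (f : Vector ℕ n) → ι (sum f) ≈ Σ[ (ι ∘ f) ]
  ι-sum {zero}  f = refl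
  ι-sum {suc n} f = trans (×-homo-+ 1# (f zero) (sum (tail f))) (+-congˡ (ι-sum (tail f)))

  Σ-cong : ∀ {n} {f g : Vector Carrier n} → (∀ i → f i ≈ g i) → Σ[ f ] ≈ Σ[ g ]
  Σ-cong = KΣ.sum-cong-≋

  -- This is (a b) d = a (b d) for a row `a`, a matrix `b` and a column `d`: expand and exchange the
  -- two summations.
  Σ-assoc : ∀ {m n} (a : Vector Carrier m) (b : Fin m → Fin n → Carrier) (d : Vector Carrier n) →
    Σ[ (λ i → Σ[ (λ u → a u * b u i) ] * d i) ] ≈ Σ[ (λ u → a u * Σ[ (λ i → b u i * d i) ]) ]
  Σ-assoc {m} a b d = begin
    Σ[ (λ i → Σ[ (λ u → a u * b u i) ] * d i) ]
      ≈⟨ Σ-cong (λ i → trans (KΣ.*-distribʳ-sum (d i) (λ u → a u * b u i))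
             (Σ-cong {m} (λ u → *-assoc _ _ _))) ⟩
    Σ[ (λ i → Σ[ (λ u → a u * (b u i * d i)) ]) ]
      ≈⟨ KΣ.∑-comm (λ i u → a u * (b u i * d i)) ⟩
    Σ[ (λ u → Σ[ (λ i → a u * (b u i * d i)) ]) ]
      ≈⟨ Σ-cong (λ u → sym (KΣ.*-distribˡ-sum (a u) (λ i → b u i * d i))) ⟩
    Σ[ (λ u → a u * Σ[ (λ i → b u i * d i) ]) ] ∎

  -- Kronecker's delta, recursive in both indices so that `Σ-δ` goes by induction on the index.
  δ : ∀ {n} → Fin n → Fin n → Carrier
  δ zero    zero    = 1#
  δ zero    (suc j) = 0#
  δ (suc i) zero    = 0#
  δ (suc i) (suc j) = δ i j

  δ-refl : ∀ {n} (i : Fin n) → δ i i ≈ 1#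
  δ-refl zero    = refl
  δ-refl (suc i) = δ-refl i

  δ-sym : ∀ {n} (i j : Fin n) → δ i j ≈ δ j i
  δ-sym zero    zero    = refl
  δ-sym zero    (suc j) = refl
  δ-sym (suc i) zero    = refl
  δ-sym (suc i) (suc j) = δ-sym i j

  Σ-δ : ∀ {n} (i : Fin n) (f : Vector Carrier n) → Σ[ (λ j → δ i j * f j) ] ≈ f i
  Σ-δ {suc n} zero f = begin
    1# * f zero + Σ[ (λ j → 0# * f (suc j)) ]
      ≈⟨ +-cong (*-identityˡ _)
           (trans (Σ-cong {n} (λ j → zeroˡ (f (suc j)))) (KΣ.sum-replicate-zero n)) ⟩
    f zero + 0#  ≈⟨ +-identityʳ _ ⟩
    f zero       ∎
  Σ-δ (suc i) f = trans (+-cong (zeroˡ _) (Σ-δ i (tail f))) (+-identityˡ _)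

  module _ {n} {G : Graph n} (sp : Spectrum K G) where
    open Spectrum sp

    coordinate : Fin n → Fin n → Carrier
    coordinate u = proj₁ (spanning (δ u))

    Σ-coordinate : ∀ u v → Σ[ (λ j → coordinate u j * eigenvector j v) ] ≈ δ u v
    Σ-coordinate u = proj₂ (spanning (δ u))

    coefficients-unique : (a b : Vector Carrier n) →
      (∀ u → Σ[ (λ j → a j * eigenvector j u) ] ≈ Σ[ (λ j → b j * eigenvector j u) ]) →
      ∀ j → a j ≈ b j
    coefficients-unique a b eq j =
      GroupProperties.x∙y⁻¹≈ε⇒x≈y +-group (a j) (b j) (independent (λ i → a i - b i) vanishes j)
      where
      _·V_ : Vector Carrier n → Fin n → Carrier
      x ·V u = Σ[ (λ i → x i * eigenvector i u) ]
      ·V-+ : ∀ x y u → (λ i → x i + y i) ·V u ≈ x ·V u + y ·V u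
      ·V-+ x y u = trans (Σ-cong (λ i → distribʳ (eigenvector i u) (x i) (y i)))
        (KΣ.∑-distrib-+ (λ i → x i * eigenvector i u) (λ i → y i * eigenvector i u))
      vanishes : ∀ u → (λ i → a i - b i) ·V u ≈ 0#
      vanishes u = begin
        (λ i → a i - b i) ·V u      ≈⟨ ·V-+ a (-_ ∘ b) u ⟩
        a ·V u + (-_ ∘ b) ·V u      ≈⟨ +-congʳ (eq u) ⟩
        b ·V u + (-_ ∘ b) ·V u      ≈⟨ ·V-+ b (-_ ∘ b) u ⟨
        (λ i → b i - b i) ·V u
          ≈⟨ Σ-cong (λ i → trans (*-congʳ (-‿inverseʳ (b i))) (zeroˡ (eigenvector i u))) ⟩
        Σ[ (λ (_ : Fin n) → 0#) ]   ≈⟨ KΣ.sum-replicate-zero n ⟩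
        0#                          ∎

    -- `Σ-coordinate` makes `coordinate` a left inverse of the matrix whose rows are the
    -- eigenvectors; here it becomes a right inverse. Both rows, used as coefficients, produce
    -- `eigenvector j`, so `coefficients-unique` identifies them.
    biorthogonal : ∀ j i → Σ[ (λ u → eigenvector j u * coordinate u i) ] ≈ δ j i
    biorthogonal j = coefficients-unique _ (δ j) λ x → begin
      Σ[ (λ i → Σ[ (λ u → eigenvector j u * coordinate u i) ] * eigenvector i x) ]
        ≈⟨ Σ-assoc (eigenvector j) coordinate (λ i → eigenvector i x) ⟩
      Σ[ (λ u → eigenvector j u * Σ[ (λ i → coordinate u i * eigenvector i x) ]) ]
        ≈⟨ Σ-cong (λ u → trans (*-congˡ (trans (Σ-coordinate u x) (δ-sym u x))) (*-comm _ _)) ⟩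
      Σ[ (λ u → δ x u * eigenvector j u) ]
        ≈⟨ Σ-δ x (eigenvector j) ⟩
      eigenvector j x
        ≈⟨ Σ-δ j (λ i → eigenvector i x) ⟨
      Σ[ (λ i → δ j i * eigenvector i x) ] ∎

    -- Powers of the adjacency matrix are recognised by their effect on the eigenbasis, so any
    -- bracketing of a product qualifies.
    record ActsAsPower (k : ℕ) (M : Matrix n) : Set (c ⊔ ℓ₁) where
      constructor acts
      field
        apply : ∀ j u →
          Σ[ (λ v → ι (M u v) * eigenvector j v) ] ≈ eigenvalue j ^ k * eigenvector j u

    adjacency-acts : ActsAsPower 1 (adjacency G)
    adjacency-acts = acts λ j u → begin
      Σ[ (λ v → ι (adjacency G u v) * eigenvector j v) ]
        ≈⟨ Σ-cong (λ v → *-congʳ (ι-entry (Graph.adj G u v))) ⟩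
      Σ[ (λ v → adjacencyMatrix K G u v * eigenvector j v) ]
        ≈⟨ eigen j u ⟩
      eigenvalue j * eigenvector j u
        ≈⟨ *-congʳ (*-identityʳ _) ⟨
      eigenvalue j ^ 1 * eigenvector j u ∎
      where
      ι-entry : ∀ b → ι (entry b) ≈ (if b then 1# else 0#)
      ι-entry false = refl
      ι-entry true  = +-identityʳ 1#

    -- After reassociation `N` acts first and contributes `e ^ l`; then `M` contributes `e ^ k`.
    ⊗-acts : ∀ {k l M N} → ActsAsPower k M → ActsAsPower l N → ActsAsPower (k ℕ.+ l) (M ⊗ N)
    ⊗-acts {k} {l} {M} {N} (acts actsM) (acts actsN) = acts λ j u →
      let V = eigenvector j; e = eigenvalue j in begin
      Σ[ (λ v → ι ((M ⊗ N) u v) * V v) ]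
        ≈⟨ Σ-cong (λ v → *-congʳ (trans (ι-sum (λ x → M u x ℕ.* N x v))
             (Σ-cong (λ x → ×1-homo-* (M u x) (N x v))))) ⟩
      Σ[ (λ v → Σ[ (λ x → ι (M u x) * ι (N x v)) ] * V v) ]
        ≈⟨ Σ-assoc (ι ∘ M u) (λ x v → ι (N x v)) V ⟩
      Σ[ (λ x → ι (M u x) * Σ[ (λ v → ι (N x v) * V v) ]) ]
        ≈⟨ Σ-cong (λ x → trans (*-congˡ (actsN j x)) (x∙yz≈y∙xz _ _ _)) ⟩
      Σ[ (λ x → e ^ l * (ι (M u x) * V x)) ]
        ≈⟨ KΣ.*-distribˡ-sum (e ^ l) (λ x → ι (M u x) * V x) ⟨
      e ^ l * Σ[ (λ x → ι (M u x) * V x) ]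
        ≈⟨ *-congˡ (actsM j u) ⟩
      e ^ l * (e ^ k * V u)
        ≈⟨ trans (x∙yz≈y∙xz _ _ _) (sym (*-assoc _ _ _)) ⟩
      e ^ k * e ^ l * V u
        ≈⟨ *-congʳ (^-homo-* e k l) ⟨
      e ^ (k ℕ.+ l) * V u ∎

    -- Expanding the standard basis in the eigenbasis turns each diagonal entry of `M` into a
    -- combination of the powers `eigenvalue j ^ k`. Summed over `u`, the factor of the j-th power
    -- is a diagonal entry in `biorthogonal`, that is, 1.
    power-sum≈trace : ∀ {k M} → ActsAsPower k M → Σ[ (λ j → eigenvalue j ^ k) ] ≈ ι (trace M)
    power-sum≈trace {k} {M} (acts applyM) = sym (begin
      ι (trace M)
        ≈⟨ ι-sum (λ u → M u u) ⟩
      Σ[ (λ u → ι (M u u)) ]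
        ≈⟨ Σ-cong diagonal ⟩
      Σ[ (λ u → Σ[ (λ j → coordinate u j * (eigenvalue j ^ k * eigenvector j u)) ]) ]
        ≈⟨ KΣ.∑-comm (λ u j → coordinate u j * (eigenvalue j ^ k * eigenvector j u)) ⟩
      Σ[ (λ j → Σ[ (λ u → coordinate u j * (eigenvalue j ^ k * eigenvector j u)) ]) ]
        ≈⟨ Σ-cong (λ j → trans
             (Σ-cong {n} (λ u → trans (x∙yz≈y∙xz _ _ _) (*-congˡ (*-comm _ _))))
             (sym (KΣ.*-distribˡ-sum (eigenvalue j ^ k) (λ u → eigenvector j u * coordinate u j)))) ⟩
      Σ[ (λ j → eigenvalue j ^ k * Σ[ (λ u → eigenvector j u * coordinate u j) ]) ]
        ≈⟨ Σ-cong (λ j → trans (*-congˡ (trans (biorthogonal j j) (δ-refl j))) (*-identityʳ _)) ⟩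
      Σ[ (λ j → eigenvalue j ^ k) ] ∎)
      where
      diagonal : ∀ u → ι (M u u) ≈ Σ[ (λ j → coordinate u j * (eigenvalue j ^ k * eigenvector j u)) ]
      diagonal u = begin
        ι (M u u)
          ≈⟨ Σ-δ u (λ v → ι (M u v)) ⟨
        Σ[ (λ v → δ u v * ι (M u v)) ]
          ≈⟨ Σ-cong (λ v → *-congʳ (Σ-coordinate u v)) ⟨
        Σ[ (λ v → Σ[ (λ j → coordinate u j * eigenvector j v) ] * ι (M u v)) ]
          ≈⟨ Σ-assoc (coordinate u) eigenvector (λ v → ι (M u v)) ⟩
        Σ[ (λ j → coordinate u j * Σ[ (λ v → eigenvector j v * ι (M u v)) ]) ]
          ≈⟨ Σ-cong (λ j → *-congˡ (trans (Σ-cong {n} (λ v → *-comm _ _)) (applyM j u))) ⟩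
        Σ[ (λ j → coordinate u j * (eigenvalue j ^ k * eigenvector j u)) ] ∎

open import Data.Nat.Base using (_+_; _*_; _≤_; _<_)
open ≡ using (refl; sym; trans; cong; cong₂; subst; subst₂; ≢-sym; module ≡-Reasoning)

-- Majorization

-- By Abel summation each side combines partial sums with the weights aᵢ - aᵢ₊₁ and, for the full
-- sum, the last entry of `a`; none of these is negative.
∑-product-≤ : ∀ {n} (a x y : Vector ℕ n) → NonIncreasing a →
  (∀ k → partialSum x k ≤ partialSum y k) →
  sum (λ i → a i * x i) ≤ sum (λ i → a i * y i)
∑-product-≤ {zero}  a x y a↓ x≤y = z≤n
∑-product-≤ {suc n} a x y a↓ x≤y =
  -- Both carries start at 0, with `a zero` as the first bound on the entries.
  ℕ.+-cancelˡ-≤ (a zero * 0) _ _ (withCarry a x y (a zero) 0 0 a↓ (λ i → a↓ z≤n) z≤n x≤y)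
  where
  -- The carries p and q stand for the entries before the current ones.
  withCarry : ∀ {n} (a x y : Vector ℕ n) A p q → NonIncreasing a → (∀ i → a i ≤ A) → p ≤ q →
    (∀ k → p + partialSum x k ≤ q + partialSum y k) →
    A * p + sum (λ i → a i * x i) ≤ A * q + sum (λ i → a i * y i)
  withCarry {zero}  a x y A p q a↓ a≤A p≤q _ = ℕ.+-monoˡ-≤ 0 (ℕ.*-monoʳ-≤ A p≤q)
  withCarry {suc n} a x y A p q a↓ a≤A p≤q x≤y = begin
    -- Of the weight `A` of the carry, the part `A ∸ a₀` is settled by `p ≤ q`; the rest, `a₀`, is
    -- the weight of the head, so both merge into the next carry.
    A * p + (a₀ * x zero + X)              ≡⟨ regroup p (x zero) X ⟩
    (A ∸ a₀) * p + (a₀ * (p + x zero) + X) ≤⟨ ℕ.+-mono-≤ (ℕ.*-monoʳ-≤ (A ∸ a₀) p≤q)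
      (withCarry (tail a) (tail x) (tail y) a₀ (p + x zero) (q + y zero)
        (λ i≤j → a↓ (s≤s i≤j)) (λ i → a↓ z≤n) first rest) ⟩
    (A ∸ a₀) * q + (a₀ * (q + y zero) + Y) ≡⟨ regroup q (y zero) Y ⟨
    A * q + (a₀ * y zero + Y)              ∎
    where
    open ℕ.≤-Reasoning
    a₀ = a zero
    X = sum (λ i → a (suc i) * x (suc i))
    Y = sum (λ i → a (suc i) * y (suc i))
    first : p + x zero ≤ q + y zero
    first = begin
      p + x zero        ≡⟨ cong (p +_) (ℕ.+-identityʳ (x zero)) ⟨
      p + (x zero + 0)  ≤⟨ x≤y zero ⟩
      q + (y zero + 0)  ≡⟨ cong (q +_) (ℕ.+-identityʳ (y zero)) ⟩
      q + y zero        ∎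
    rest : ∀ k → p + x zero + partialSum (tail x) k ≤ q + y zero + partialSum (tail y) k
    rest k = begin
      p + x zero + partialSum (tail x) k    ≡⟨ ℕ.+-assoc p _ _ ⟩
      p + (x zero + partialSum (tail x) k)  ≤⟨ x≤y (suc k) ⟩
      q + (y zero + partialSum (tail y) k)  ≡⟨ ℕ.+-assoc q _ _ ⟨
      q + y zero + partialSum (tail y) k    ∎
    regroup : ∀ p x₀ X → A * p + (a₀ * x₀ + X) ≡ (A ∸ a₀) * p + (a₀ * (p + x₀) + X)
    regroup p x₀ X = trans
      (cong (λ A → A * p + (a₀ * x₀ + X)) (sym (ℕ.m∸n+n≡m (a≤A zero))))
      (solve 5 (λ d a p x X → (d :+ a) :* p :+ (a :* x :+ X) := d :* p :+ (a :* (p :+ x) :+ X))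
        refl (A ∸ a₀) a₀ p x₀ X)
      where open +-*-Solver

2mn+[n∸m]²≡m²+n² : ∀ {m n} → m ≤ n → m * n + m * n + (n ∸ m) * (n ∸ m) ≡ m * m + n * n
2mn+[n∸m]²≡m²+n² {m} {n} m≤n = subst
  (λ n′ → m * n′ + m * n′ + (n ∸ m) * (n ∸ m) ≡ m * m + n′ * n′) (ℕ.m+[n∸m]≡n m≤n)
  (solve 2 (λ m d → m :* (m :+ d) :+ m :* (m :+ d) :+ d :* d := m :* m :+ (m :+ d) :* (m :+ d))
    refl m (n ∸ m))
  where open +-*-Solver

m<n⇒mn+mn<m²+n² : ∀ {m n} → m < n → m * n + m * n < m * m + n * n
m<n⇒mn+mn<m²+n² {m} {n} m<n = subst (m * n + m * n <_) (2mn+[n∸m]²≡m²+n² (ℕ.<⇒≤ m<n))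
  (ℕ.m<m+n _ (ℕ.*-mono-< (ℕ.m<n⇒0<n∸m m<n) (ℕ.m<n⇒0<n∸m m<n)))

mn+mn<m²+n² : ∀ {m n} → m ≢ n → m * n + m * n < m * m + n * n
mn+mn<m²+n² {m} {n} m≢n with ℕ.<-cmp m n
... | tri< m<n _ _ = m<n⇒mn+mn<m²+n² m<n
... | tri≈ _ m≡n _ = contradiction m≡n m≢n
... | tri> _ _ n<m =
  subst₂ _<_ (cong₂ _+_ (ℕ.*-comm n m) (ℕ.*-comm n m)) (ℕ.+-comm (n * n) (m * m))
    (m<n⇒mn+mn<m²+n² n<m)

mn+mn≤m²+n² : ∀ m n → m * n + m * n ≤ m * m + n * n
mn+mn≤m²+n² m n with m ℕ.≟ n
... | yes refl = ℕ.≤-refl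
... | no  m≢n  = ℕ.<⇒≤ (mn+mn<m²+n² m≢n)

sum-mono-≤ : ∀ {n} {f g : Vector ℕ n} → (∀ i → f i ≤ g i) → sum f ≤ sum g
sum-mono-≤ {zero}  f≤g = z≤n
sum-mono-≤ {suc n} f≤g = ℕ.+-mono-≤ (f≤g zero) (sum-mono-≤ (f≤g ∘ suc))

sum-mono-< : ∀ {n} {f g : Vector ℕ n} → (∀ i → f i ≤ g i) → ∀ i → f i < g i → sum f < sum g
sum-mono-< f≤g zero    f<g = ℕ.+-mono-<-≤ f<g (sum-mono-≤ (f≤g ∘ suc))
sum-mono-< f≤g (suc i) f<g = ℕ.+-mono-≤-< (f≤g zero) (sum-mono-< (f≤g ∘ suc) i f<g)

∑-square-< : ∀ {n} (x y : Vector ℕ n) → NonIncreasing x → ¬ (x ≗ y) → x ⊲ y →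
  sum (λ i → x i * x i) < sum (λ i → y i * y i)
-- Equality in ℕ is decidable and the index set finite, so there is an explicit index at which `x`
-- and `y` differ. The inequality 2mn ≤ m² + n² is strict there.
∑-square-< {n} x y x↓ x≢y (x≤y , _) with ¬∀⟶∃¬ n (λ i → x i ≡ y i) (λ i → x i ℕ.≟ y i) x≢y
... | i , xᵢ≢yᵢ = ℕ.+-cancelˡ-< (x · x) (x · x) (y · y) (begin-strict
  x · x + x · x                          ≤⟨ ℕ.+-mono-≤ x·x≤x·y x·x≤x·y ⟩
  x · y + x · y                          ≡⟨ ∑-distrib-+ (λ i → x i * y i) (λ i → x i * y i) ⟨
  sum (λ i → x i * y i + x i * y i)
    <⟨ sum-mono-< (λ i → mn+mn≤m²+n² (x i) (y i)) i (mn+mn<m²+n² xᵢ≢yᵢ) ⟩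
  sum (λ i → x i * x i + y i * y i)      ≡⟨ ∑-distrib-+ (λ i → x i * x i) (λ i → y i * y i) ⟩
  x · x + y · y                          ∎)
  where
  open ℕ.≤-Reasoning
  _·_ : Vector ℕ n → Vector ℕ n → ℕ
  x · y = sum (λ i → x i * y i)
  x·x≤x·y : x · x ≤ x · y
  x·x≤x·y = ∑-product-≤ x x y x↓ x≤y

-- Closed walks in trees

sum-zero : ∀ {n} {f : Vector ℕ n} → (∀ i → f i ≡ 0) → sum f ≡ 0
sum-zero {n} f≡0 = trans (sum-cong-≗ f≡0) (sum-replicate-zero n)

-- The hypotheses say that every entry is 0 or 1 and at most one is nonzero, so the sum is 0 or 1.
-- In products this is just the vanishing of the cross terms of the square.
sum-square : ∀ {n} (f : Vector ℕ n) → (∀ i → f i * f i ≡ f i) → (∀ i j → i ≢ j → f i * f j ≡ 0) →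
  sum f * sum f ≡ sum f
sum-square {zero}  f idem orth = refl
sum-square {suc n} f idem orth = begin
  (f₀ + R) * (f₀ + R)
    ≡⟨ solve 2 (λ a r → (a :+ r) :* (a :+ r) := a :* a :+ (a :* r :+ a :* r) :+ r :* r)
         refl f₀ R ⟩
  f₀ * f₀ + (f₀ * R + f₀ * R) + R * R
    ≡⟨ cong₂ _+_ (cong₂ _+_ (idem zero) (cong₂ _+_ cross cross)) square ⟩
  f₀ + 0 + R
    ≡⟨ cong (_+ R) (ℕ.+-identityʳ f₀) ⟩
  f₀ + R ∎
  where
  open ≡-Reasoning
  open +-*-Solver
  f₀ = f zero
  R = sum (tail f)
  cross : f₀ * R ≡ 0
  cross = trans (*-distribˡ-sum f₀ (tail f)) (sum-zero (λ i → orth zero (suc i) λ ()))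
  square : R * R ≡ R
  square = sum-square (tail f) (idem ∘ suc) (λ i j i≢j → orth (suc i) (suc j) (i≢j ∘ suc-injective))

-- Removing position `i` leaves equal sums; adding the removed entries crosswise states this without
-- subtraction.
sum-exchange : ∀ {n} {f g : Vector ℕ n} i → (∀ j → i ≢ j → f j ≡ g j) → sum f + g i ≡ sum g + f i
sum-exchange {suc n} {f} {g} i agree = begin
  sum f + g i
    ≡⟨ cong (_+ g i) (sum-remove {i = i} f) ⟩
  f i + sum (removeAt f i) + g i
    ≡⟨ cong (λ r → f i + r + g i) (sum-cong-≗ (λ j → agree _ (≢-sym (punchInᵢ≢i i j)))) ⟩
  f i + sum (removeAt g i) + g i
    ≡⟨ solve 3 (λ a r b → a :+ r :+ b := b :+ r :+ a) refl (f i) (sum (removeAt g i)) (g i) ⟩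
  g i + sum (removeAt g i) + f i
    ≡⟨ cong (_+ f i) (sum-remove {i = i} g) ⟨
  sum g + f i ∎
  where
  open ≡-Reasoning
  open +-*-Solver

entry-idem : ∀ b → entry b * entry b ≡ entry b
entry-idem false = refl
entry-idem true  = refl

entry₃-zero : ∀ a b c → (T a → T b → T c → ⊥) → entry a * (entry b * entry c) ≡ 0
entry₃-zero false b     c     ¬abc = refl
entry₃-zero true  false c     ¬abc = refl
entry₃-zero true  true  false ¬abc = refl
entry₃-zero true  true  true  ¬abc = ⊥-elim (¬abc tt tt tt)

entry₄-zero : ∀ a b c d → (T a → T b → T c → T d → ⊥) →
  (entry a * entry b) * (entry c * entry d) ≡ 0
entry₄-zero false b     c     d ¬abcd = refl
entry₄-zero true  false c     d ¬abcd = refl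
entry₄-zero true  true  c     d ¬abcd =
  trans (ℕ.+-identityʳ _) (trans (sym (ℕ.*-identityˡ _)) (entry₃-zero true c d (λ _ → ¬abcd tt tt)))

∣tabulate∣ : ∀ {n} (f : Fin n → Bool) → ∣ Vec.tabulate f ∣ ≡ sum (entry ∘ f)
∣tabulate∣ {zero}  f = refl
∣tabulate∣ {suc n} f with f zero
... | false = ∣tabulate∣ (f ∘ suc)
... | true  = cong suc (∣tabulate∣ (f ∘ suc))

module _ {n} (G : Graph n) where
  open Graph G using (adj; Adj; irrefl; Cycle; Connected) renaming (sym to adj-sym)

  A : Matrix n
  A = adjacency G

  A-sym : ∀ u v → A u v ≡ A v u
  A-sym u v = cong entry (adj-sym u v)

  Adj-sym : ∀ {u v} → Adj u v → Adj v u
  Adj-sym {u} {v} = subst T (adj-sym u v)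

  Adj⇒≢ : ∀ {u v} → Adj u v → u ≢ v
  Adj⇒≢ {u} uv refl = subst T (irrefl u) uv

  degree≡∑ : ∀ u → degree G u ≡ sum (A u)
  degree≡∑ u = ∣tabulate∣ (adj u)

  -- A closed walk of length two crosses an edge and returns, so `u` has one for each neighbour.
  ⊗-diagonal : ∀ u → (A ⊗ A) u u ≡ degree G u
  ⊗-diagonal u = trans
    (sum-cong-≗ (λ v → trans (cong (A u v *_) (A-sym v u)) (entry-idem (adj u v))))
    (sym (degree≡∑ u))

  trace-A : trace A ≡ 0
  trace-A = sum-zero (λ u → cong entry (irrefl u))

  trace-A² : trace (A ⊗ A) ≡ sum (degree G)
  trace-A² = sum-cong-≗ ⊗-diagonal

  triangle : ∀ {u v w} → Adj u v → Adj v w → Adj w u → Cycle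
  triangle {u} {v} {w} uv vw wu = record
    { k         = 0
    ; vertex    = Vec.lookup (u ∷ v ∷ w ∷ [])
    ; injective = lookup-injective
        ((Adj⇒≢ uv ∷ ≢-sym (Adj⇒≢ wu) ∷ []) ∷ (Adj⇒≢ vw ∷ []) ∷ [] ∷ []) _ _
    ; step      = λ { 0F → uv ; 1F → vw }
    ; close     = wu
    }

  -- Adjacency separates the four consecutive pairs of vertices; only the two diagonals need
  -- assumptions.
  square : ∀ {u v w x} → u ≢ w → v ≢ x → Adj u v → Adj v w → Adj w x → Adj x u → Cycle
  square {u} {v} {w} {x} u≢w v≢x uv vw wx xu = record
    { k         = 1
    ; vertex    = Vec.lookup (u ∷ v ∷ w ∷ x ∷ [])
    ; injective = lookup-injective
        ((Adj⇒≢ uv ∷ u≢w ∷ ≢-sym (Adj⇒≢ xu) ∷ []) ∷ (Adj⇒≢ vw ∷ v≢x ∷ []) ∷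
         (Adj⇒≢ wx ∷ []) ∷ [] ∷ []) _ _
    ; step      = λ { 0F → uv ; 1F → vw ; 2F → wx }
    ; close     = xu
    }

  module _ (acyclic : ¬ Cycle) where
    -- A nonzero summand would be a closed walk of length three, hence a triangle.
    trace-A³ : trace (A ⊗ A ⊗ A) ≡ 0
    trace-A³ = sum-zero λ u → sum-zero λ v →
      trans (*-distribˡ-sum (A u v) (λ w → A v w * A w u)) (sum-zero λ w →
        entry₃-zero (adj u v) (adj v w) (adj w u) (λ uv vw wu → acyclic (triangle uv vw wu)))

    -- Two common neighbours `v` and `x` of distinct `u` and `w` would close a 4-cycle u, v, w, x,
    -- so the entry is 0 or 1.
    common-neighbours-idem : ∀ u w → u ≢ w → (A ⊗ A) u w * (A ⊗ A) u w ≡ (A ⊗ A) u w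
    common-neighbours-idem u w u≢w = sum-square (λ v → A u v * A v w)
      (λ v → trans (ℕ.[m*n]*[o*p]≡[m*o]*[n*p] (A u v) (A v w) (A u v) (A v w))
        (cong₂ _*_ (entry-idem (adj u v)) (entry-idem (adj v w))))
      (λ v x v≢x → entry₄-zero (adj u v) (adj v w) (adj u x) (adj x w) (λ uv vw ux xw →
        acyclic (square u≢w v≢x uv vw (Adj-sym xw) (Adj-sym ux))))

    -- The trace is the sum of the squared entries of `C`. Off the diagonal they equal the entries
    -- themselves, on it they are squared degrees, and the sum of all entries of `C` counts walks of
    -- length two.
    trace-A⁴ : trace ((A ⊗ A) ⊗ (A ⊗ A)) + sum (degree G) ≡
      sum (λ v → degree G v * degree G v) + sum (λ v → degree G v * degree G v)
    trace-A⁴ = begin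
      trace (C ⊗ C) + sum d                              ≡⟨ ∑-distrib-+ (λ u → (C ⊗ C) u u) d ⟨
      sum (λ u → (C ⊗ C) u u + d u)                      ≡⟨ sum-cong-≗ closed-at ⟩
      sum (λ u → sum (C u) + d u * d u)                  ≡⟨ ∑-distrib-+ (λ u → sum (C u)) (λ u → d u * d u) ⟩
      sum (λ u → sum (C u)) + sum (λ u → d u * d u)      ≡⟨ cong (_+ sum (λ u → d u * d u)) ∑-C ⟩
      sum (λ u → d u * d u) + sum (λ u → d u * d u)      ∎
      where
      open ≡-Reasoning
      d = degree G
      C = A ⊗ A
      C-sym : ∀ u w → C u w ≡ C w u
      C-sym u w = sum-cong-≗ (λ v → trans (ℕ.*-comm (A u v) (A v w)) (cong₂ _*_ (A-sym v w) (A-sym u v)))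
      closed-at : ∀ u → (C ⊗ C) u u + d u ≡ sum (C u) + d u * d u
      closed-at u = begin
        (C ⊗ C) u u + d u
          ≡⟨ cong₂ _+_ (sum-cong-≗ (λ w → cong (C u w *_) (C-sym w u))) (sym (⊗-diagonal u)) ⟩
        sum (λ w → C u w * C u w) + C u u
          -- Row `u` and its entrywise square differ at most in the diagonal position.
          ≡⟨ sum-exchange u (common-neighbours-idem u) ⟩
        sum (C u) + C u u * C u u
          ≡⟨ cong (sum (C u) +_) (cong₂ _*_ (⊗-diagonal u) (⊗-diagonal u)) ⟩
        sum (C u) + d u * d u ∎
      -- Walks of length two are sorted by their middle vertex `v`, with `d v` choices for either
      -- end.
      ∑-C : sum (λ u → sum (C u)) ≡ sum (λ v → d v * d v)
      ∑-C = begin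
        sum (λ u → sum (λ w → sum (λ v → A u v * A v w)))
          ≡⟨ sum-cong-≗ (λ u → ∑-comm (λ w v → A u v * A v w)) ⟩
        sum (λ u → sum (λ v → sum (λ w → A u v * A v w)))
          ≡⟨ ∑-comm (λ u v → sum (λ w → A u v * A v w)) ⟩
        sum (λ v → sum (λ u → sum (λ w → A u v * A v w)))
          ≡⟨ sum-cong-≗ (λ v → sum-cong-≗ (λ u → sym (trans
               (cong₂ _*_ (A-sym v u) (degree≡∑ v)) (*-distribˡ-sum (A u v) (A v))))) ⟩
        sum (λ v → sum (λ u → A v u * d v))
          ≡⟨ sum-cong-≗ (λ v → sym (trans (cong (_* d v) (degree≡∑ v)) (*-distribʳ-sum (d v) (A v)))) ⟩
        sum (λ v → d v * d v) ∎

  -- Trees on at most three vertices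

  ≤sum : ∀ {m} (f : Vector ℕ m) i → f i ≤ sum f
  ≤sum {suc m} f i = subst (f i ≤_) (sym (sum-remove {i = i} f)) (ℕ.m≤m+n (f i) _)

  -- A path from `u` to another vertex has a first edge.
  connected⇒0<∑ : Connected → ∀ {u v} → u ≢ v → 0 < sum (A u)
  connected⇒0<∑ connected {u} {v} u≢v with connected u v
  ... | ε = contradiction refl u≢v
  ... | _◅_ {j = w} uw _ =
    ℕ.<-≤-trans (subst (λ b → 0 < entry b) (sym (Equivalence.to T-≡ uw)) (s≤s z≤n)) (≤sum (A u) w)

-- n (n − 1) merely interpolates the values 0, 0, 2, 6 attained by the paths.
∑-degree²-small : ∀ {n} (G : Graph n) → IsTree G → n ≤ 3 →
  sum (λ v → degree G v * degree G v) ≡ n * (n ∸ 1)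
∑-degree²-small {n} G (connected , acyclic) n≤3 =
  trans (sum-cong-≗ (λ v → cong₂ _*_ (degree≡∑ G v) (degree≡∑ G v))) (go n≤3 G connected acyclic)
  where
  go : ∀ {n} → n ≤ 3 → (G : Graph n) → Graph.Connected G → ¬ Graph.Cycle G →
    sum (λ v → sum (adjacency G v) * sum (adjacency G v)) ≡ n * (n ∸ 1)
  go {0} _ G connected acyclic = refl
  go {1} _ G connected acyclic rewrite Graph.irrefl G 0F = refl
  go {2} _ G connected acyclic
    -- Positivity is bound before the adjacency is abstracted, so that its type is refined too and
    -- rules out the missing edge.
    with pos₀ ← connected⇒0<∑ G connected {0F} {1F} (λ ())
    rewrite Graph.irrefl G 0F | Graph.irrefl G 1F | Graph.sym G 1F 0F
    with Graph.adj G 0F 1F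
  ... | true = refl
  go {3} _ G connected acyclic
    -- With at most one edge some vertex is isolated, against positivity, and three edges form a
    -- triangle; the three paths remain.
    with pos₀ ← connected⇒0<∑ G connected {0F} {1F} (λ ())
       | pos₁ ← connected⇒0<∑ G connected {1F} {0F} (λ ())
       | pos₂ ← connected⇒0<∑ G connected {2F} {0F} (λ ())
       | no-triangle ← (λ uv vw wu → acyclic (triangle G {0F} {1F} {2F} uv vw wu))
    rewrite Graph.irrefl G 0F | Graph.irrefl G 1F | Graph.irrefl G 2F
          | Graph.sym G 1F 0F | Graph.sym G 2F 0F | Graph.sym G 2F 1F
    with Graph.adj G 0F 1F | Graph.adj G 0F 2F | Graph.adj G 1F 2F
  ... | true  | true  | true  = ⊥-elim (no-triangle tt tt tt)
  ... | true  | true  | false = refl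
  ... | true  | false | true  = refl
  ... | false | true  | true  = refl
  go {suc (suc (suc (suc _)))} (s≤s (s≤s (s≤s ())))

-- Comparison of the power sums of the two trees

↭⇒∑≡ : ∀ {n} (f : ℕ → ℕ) (x y : Vector ℕ n) → x ↭ y → sum (f ∘ x) ≡ sum (f ∘ y)
↭⇒∑≡ f x y (ρ , x∘ρ≡y) =
  trans (sum-permute (f ∘ x) ρ) (sum-cong-≗ (λ i → cong f (x∘ρ≡y i)))

theorem3p5 : ∀ {c ℓ₁ ℓ₂ ℓ₃} (K : OrderedField c ℓ₁ ℓ₂ ℓ₃)
    (n : ℕ) (spectrum : (G : Graph n) → Spectrum K G) →
    let open SOrder K spectrum in
    -- For n = 4 the claim fails: see the remark at _≺ₛ_.
    n ≢ 4 →
    (π π′ : Vector ℕ n) →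
    NonIncreasing π → NonIncreasing π′ →
    IsTreeDegreeSequence π → IsTreeDegreeSequence π′ →
    ¬ (π ≗ π′) → π ⊲ π′ →
    (T* T′* : Graph n) →
    IsLastIn (𝒯 π) T* → IsLastIn (𝒯 π′) T′* →
    T* ≺ₛ T′*
theorem3p5 K n spectrum n≢4 π π′ π↓ _ _ _ π≢π′ π⊲π′ T* T′* ((tree , d↭π) , _) ((tree′ , d′↭π′) , _) =
  -- The first difference is at index 4. The comparison of closed walk counts in ℕ is carried into
  -- the field by `ι-mono-<`.
  4 , s≤s z≤n , ℕ.pred-mono-≤ 5≤n , agree ,
  <.<-respˡ-≈ (K.sym (power-sum≈trace (spectrum T*) (acts₄ T*)))
    (<.<-respʳ-≈ (K.sym (power-sum≈trace (spectrum T′*) (acts₄ T′*))) (ι-mono-< closed-walks-<))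
  where
  open SOrder K spectrum
  open Spectral K
  module K = OrderedField K

  d² : Graph n → ℕ
  d² G = sum (λ v → degree G v * degree G v)

  ∑d≡ : sum (degree T*) ≡ sum (degree T′*)
  ∑d≡ = trans (↭⇒∑≡ id (degree T*) π d↭π) (trans (proj₂ π⊲π′) (sym (↭⇒∑≡ id (degree T′*) π′ d′↭π′)))

  d²-< : d² T* < d² T′*
  d²-< = subst₂ _<_ (sym (↭⇒∑≡ (λ m → m * m) (degree T*) π d↭π))
    (sym (↭⇒∑≡ (λ m → m * m) (degree T′*) π′ d′↭π′))
    (∑-square-< π π′ π↓ π≢π′ π⊲π′)

  5≤n : 5 ≤ n
  5≤n = ℕ.≤∧≢⇒< (ℕ.≰⇒> λ n≤3 → ℕ.<-irrefl
    (trans (∑-degree²-small T* tree n≤3) (sym (∑-degree²-small T′* tree′ n≤3))) d²-<) (≢-sym n≢4)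

  A² A³ A⁴ : Graph n → Matrix n
  A² G = adjacency G ⊗ adjacency G
  A³ G = adjacency G ⊗ A² G
  -- Bracketed as a square of `A²`, the form in which `trace-A⁴` counts common neighbours.
  A⁴ G = A² G ⊗ A² G

  acts₁ : ∀ G → ActsAsPower (spectrum G) 1 (adjacency G)
  acts₁ G = adjacency-acts (spectrum G)

  acts₂ : ∀ G → ActsAsPower (spectrum G) 2 (A² G)
  acts₂ G = ⊗-acts (spectrum G) (acts₁ G) (acts₁ G)

  acts₃ : ∀ G → ActsAsPower (spectrum G) 3 (A³ G)
  acts₃ G = ⊗-acts (spectrum G) (acts₁ G) (acts₂ G)

  acts₄ : ∀ G → ActsAsPower (spectrum G) 4 (A⁴ G)
  acts₄ G = ⊗-acts (spectrum G) (acts₂ G) (acts₂ G)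

  closed-walks-< : trace (A⁴ T*) < trace (A⁴ T′*)
  -- Adding the degree sum, which is common to both trees, brings both sides into the form of
  -- `trace-A⁴`.
  closed-walks-< = ℕ.+-cancelʳ-< (sum (degree T*)) _ _ (begin-strict
    trace (A⁴ T*) + sum (degree T*)     ≡⟨ trace-A⁴ T* (proj₂ tree) ⟩
    d² T* + d² T*                       <⟨ ℕ.+-mono-< d²-< d²-< ⟩
    d² T′* + d² T′*                     ≡⟨ trace-A⁴ T′* (proj₂ tree′) ⟨
    trace (A⁴ T′*) + sum (degree T′*)   ≡⟨ cong (trace (A⁴ T′*) +_) ∑d≡ ⟨
    trace (A⁴ T′*) + sum (degree T*)    ∎)
    where open ℕ.≤-Reasoning

  S-cong : ∀ {k} {M : Graph n → Matrix n} → (∀ G → ActsAsPower (spectrum G) k (M G)) →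
    trace (M T*) ≡ trace (M T′*) → S k T* K.≈ S k T′*
  S-cong M-acts eq = K.trans (power-sum≈trace (spectrum T*) (M-acts T*))
    (K.trans (K.reflexive (cong ι eq)) (K.sym (power-sum≈trace (spectrum T′*) (M-acts T′*))))

  agree : ∀ i → i < 4 → S i T* K.≈ S i T′*
  -- Zeroth powers reduce to `1#`, so both sides are the same sum of `n` ones.
  agree 0 _ = K.refl
  agree 1 _ = S-cong acts₁ (trans (trace-A T*) (sym (trace-A T′*)))
  agree 2 _ = S-cong acts₂ (trans (trace-A² T*) (trans ∑d≡ (sym (trace-A² T′*))))
  agree 3 _ = S-cong acts₃ (trans (trace-A³ T* (proj₂ tree)) (sym (trace-A³ T′* (proj₂ tree′))))
  agree (suc (suc (suc (suc _)))) (s≤s (s≤s (s≤s (s≤s ()))))
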